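{- Let $\lambda\in\mathbb{R}$ and $r\in\mathbb{N}\cup\{0\}$. For all integers $n,m,k\ge0$ with $n\ge m+k$, $$\binom{m+k}{m}S_{2,r}(n+r,m+k+r|\lambda)=\sum_{l=m}^{n-k}\binom{n}{l}\,S_{2,r}(l+r,m+r|\lambda)\,S_{2,\lambda}(n-l,k).$$
   Context: All generating functions are formal power series in $t$. For a number $y$, $(1+\lambda t)^{y/\lambda}$ denotes the formal power series $\sum_{n\ge0}(y|\lambda)_n\frac{t^n}{n!}$, where $(y|\lambda)_0=1$ and $(y|\lambda)_n=y(y-\lambda)(y-2\lambda)\cdots(y-(n-1)\lambda)$ for $n\ge1$ (for $\lambda=0$ this is the limit $e^{yt}$). The degenerate Stirling numbers of the second kind $S_{2,\lambda}(n,k)$ are defined, for $k\ge0$, by $$\frac{1}{k!}\left((1+\lambda t)^{1/\lambda}-1\right)^k=\sum_{n=k}^\infty S_{2,\lambda}(n,k)\frac{t^n}{n!}.$$ The extended degenerate Stirling numbers of the second kind $S_{2,r}(n+r,k+r|\lambda)$ are defined, for $r,k\in\mathbb{N}\cup\{0\}$, by $$\frac{1}{k!}(1+\lambda t)^{r/\lambda}\left((1+\lambda t)^{1/\lambda}-1\right)^k=\sum_{n=k}^\infty S_{2,r}(n+r,k+r|\lambda)\frac{t^n}{n!}.$$ -}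

module Defs where

open import Algebra.Bundles using (CommutativeRing)
import Algebra.Definitions.RawMonoid as RawMonoidDefs
import Algebra.Properties.Semiring.Sum as SemiringSum
import Algebra.Properties.Semiring.Mult as SemiringMult
open import Data.Fin.Base using (Fin; zero; suc; toℕ)
open import Data.Nat.Base as ℕ
  using (ℕ; zero; suc; _∸_; _≤_; _<_; _!; NonZero; s≤s⁻¹)
open import Data.Nat.Properties using (_≤?_; _!≢0; m∸n≤m; ≤-<-trans; ≰⇒>)
open import Level as Level using (_⊔_)
open import Relation.Nullary using (yes; no)

-- The real numbers enter only as a commutative ring in which every positive
-- integer is invertible (needed for the 1/n! of exponential generating
-- functions), so ℝ is replaced by an arbitrary commutative ring with this
-- property.
record ℚ-Algebra c ℓ : Set (Level.suc (c ⊔ ℓ)) where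
  field
    commutativeRing : CommutativeRing c ℓ

  open CommutativeRing commutativeRing public
  open RawMonoidDefs +-rawMonoid public using (_×_)

  field
    recip         : (n : ℕ) .{{_ : NonZero n}} → Carrier
    recip-inverse : (n : ℕ) .{{_ : NonZero n}} → (n × 1#) * recip n ≈ 1#

module DegenerateStirling {c ℓ} (A : ℚ-Algebra c ℓ) where

  open ℚ-Algebra A
  open SemiringSum semiring
    using (sum; sum⁺-syntax; sum-cong-≋; sum-replicate-zero)
  open SemiringMult semiring using (×-assoc-*; ×-congʳ)
  open import Relation.Binary.Reasoning.Setoid setoid

  1/_! : ℕ → Carrier
  1/ n ! = recip (n !) {{n !≢0}}

  -- The sum over a ≤ l ≤ b, empty when b < a.
  sumFromTo : ℕ → ℕ → (ℕ → Carrier) → Carrier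
  sumFromTo a b f = sum {suc b ∸ a} (λ i → f (a ℕ.+ toℕ i))

  syntax sumFromTo a b (λ l → x) = ∑[ l from a to b ] x

  -- A formal power series in t is its sequence of coefficients:
  -- f n is the coefficient of tⁿ.
  Series : Set c
  Series = ℕ → Carrier

  infix  4 _≋_
  infixl 6 _⊖_
  infixl 7 _⊛_
  infixr 7 _·_
  infixr 8 _^_

  _≋_ : Series → Series → Set ℓ
  f ≋ g = ∀ n → f n ≈ g n

  𝟙 : Series
  𝟙 zero    = 1#
  𝟙 (suc _) = 0#

  _⊖_ : Series → Series → Series
  (f ⊖ g) n = f n - g n

  _·_ : Carrier → Series → Series
  (x · f) n = x * f n

  _⊛_ : Series → Series → Series
  (f ⊛ g) n = ∑[ i ≤ n ] (f (toℕ i) * g (n ∸ toℕ i))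

  _^_ : Series → ℕ → Series
  f ^ zero  = 𝟙
  f ^ suc k = f ⊛ f ^ k

  -- (y|ƛ)ₙ = y (y − ƛ) ⋯ (y − (n−1)ƛ)
  fallingFactorial : Carrier → Carrier → ℕ → Carrier
  fallingFactorial ƛ y zero    = 1#
  fallingFactorial ƛ y (suc n) = fallingFactorial ƛ y n * (y - n × ƛ)

  -- (1 + ƛt)^(y/ƛ), which is e^(yt) when ƛ = 0
  degenerateExp : Carrier → Carrier → Series
  degenerateExp ƛ y n = fallingFactorial ƛ y n * 1/ n !

  stirling₂Series : Carrier → ℕ → Series
  stirling₂Series ƛ k = 1/ k ! · (degenerateExp ƛ 1# ⊖ 𝟙) ^ k

  extendedStirling₂Series : ℕ → Carrier → ℕ → Series
  extendedStirling₂Series r ƛ k =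
    1/ k ! · (degenerateExp ƛ (r × 1#) ⊛ (degenerateExp ƛ 1# ⊖ 𝟙) ^ k)

  -- The numbers are read off as n! times the coefficient of tⁿ; the defining
  -- expansions Σ_{n ≥ k} S(n,k) tⁿ/n! are verified at the end of this module.
  S₂[_,_∣_] : ℕ → ℕ → Carrier → Carrier
  S₂[ n , k ∣ ƛ ] = (n !) × stirling₂Series ƛ k n

  -- S₂⟨ r ⟩[ n +r, k +r∣ ƛ ] is S_{2,r}(n+r, k+r | ƛ): the shift by r is part
  -- of the notation, and the arguments are n and k.
  S₂⟨_⟩[_+r,_+r∣_] : ℕ → ℕ → ℕ → Carrier → Carrier
  S₂⟨ r ⟩[ n +r, k +r∣ ƛ ] = (n !) × extendedStirling₂Series r ƛ k n

  -- Σ_{n ≥ k} aₙ tⁿ/n!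
  egfFrom : ℕ → (ℕ → Carrier) → Series
  egfFrom k a n with k ≤? n
  ... | yes _ = a n * 1/ n !
  ... | no  _ = 0#

  private
    VanishesBelow : ℕ → Series → Set ℓ
    VanishesBelow k f = ∀ n → n < k → f n ≈ 0#

    sum-zero : ∀ n (f : Fin n → Carrier) → (∀ i → f i ≈ 0#) → sum {n} f ≈ 0#
    sum-zero n f f≈0 = trans (sum-cong-≋ f≈0) (sum-replicate-zero n)

    ⊛-vanishes : ∀ {k} f {g} → VanishesBelow k g → VanishesBelow k (f ⊛ g)
    ⊛-vanishes f {g} v n n<k = sum-zero (ℕ.suc n) (λ i → f (toℕ i) * g (n ∸ toℕ i)) λ i →
      trans (*-congˡ (v _ (≤-<-trans (m∸n≤m n (toℕ i)) n<k))) (zeroʳ _)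

    ^-vanishes : ∀ f → f 0 ≈ 0# → ∀ k → VanishesBelow k (f ^ k)
    ^-vanishes f f₀ zero    n ()
    ^-vanishes f f₀ (suc k) n n<1+k = sum-zero (ℕ.suc n) _ (term n n<1+k)
      where
      term : ∀ n → n < suc k → ∀ i → f (toℕ i) * (f ^ k) (n ∸ toℕ {suc n} i) ≈ 0#
      term n       _     zero    = trans (*-congʳ f₀) (zeroˡ _)
      term (suc n) n<1+k (suc i) = trans
        (*-congˡ (^-vanishes f f₀ k _ (≤-<-trans (m∸n≤m n (toℕ i)) (s≤s⁻¹ n<1+k))))
        (zeroʳ _)

    ·-vanishes : ∀ {k} x {f} → VanishesBelow k f → VanishesBelow k (x · f)
    ·-vanishes x v n n<k = trans (*-congˡ (v n n<k)) (zeroʳ x)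

    1/0!≈1 : 1/ 0 ! ≈ 1#
    1/0!≈1 = begin
      1/ 0 !               ≈⟨ *-identityˡ _ ⟨
      1# * 1/ 0 !          ≈⟨ *-congʳ (+-identityʳ 1#) ⟨
      (1 × 1#) * 1/ 0 !    ≈⟨ recip-inverse 1 ⟩
      1#                   ∎

    base-vanishes : ∀ ƛ → (degenerateExp ƛ 1# ⊖ 𝟙) 0 ≈ 0#
    base-vanishes ƛ =
      trans (+-congʳ (trans (*-identityˡ _) 1/0!≈1)) (-‿inverseʳ 1#)

    !-cancel : ∀ n x → x ≈ ((n !) × x) * 1/ n !
    !-cancel n x = begin
      x   ≈⟨ *-identityʳ x ⟨
      x * 1#   ≈⟨ *-congˡ (recip-inverse (n !) {{n !≢0}}) ⟨
      x * (((n !) × 1#) * 1/ n !)   ≈⟨ *-assoc _ _ _ ⟨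
      (x * ((n !) × 1#)) * 1/ n !   ≈⟨ *-congʳ (*-comm _ _) ⟩
      (((n !) × 1#) * x) * 1/ n !   ≈⟨ *-congʳ (×-assoc-* (n !) 1# x) ⟩
      ((n !) × (1# * x)) * 1/ n !   ≈⟨ *-congʳ (×-congʳ (n !) (*-identityˡ x)) ⟩
      ((n !) × x) * 1/ n !   ∎

    egfFrom-correct : ∀ k f → VanishesBelow k f → f ≋ egfFrom k (λ n → (n !) × f n)
    egfFrom-correct k f v n with k ≤? n
    ... | yes _   = !-cancel n (f n)
    ... | no  k≰n = v n (≰⇒> k≰n)

  stirling₂-egf : ∀ ƛ k →
    1/ k ! · (degenerateExp ƛ 1# ⊖ 𝟙) ^ k ≋ egfFrom k (λ n → S₂[ n , k ∣ ƛ ])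
  stirling₂-egf ƛ k = egfFrom-correct k _
    (·-vanishes _ (^-vanishes _ (base-vanishes ƛ) k))

  extendedStirling₂-egf : ∀ r ƛ k →
    1/ k ! · (degenerateExp ƛ (r × 1#) ⊛ (degenerateExp ƛ 1# ⊖ 𝟙) ^ k)
      ≋ egfFrom k (λ n → S₂⟨ r ⟩[ n +r, k +r∣ ƛ ])
  extendedStirling₂-egf r ƛ k = egfFrom-correct k _
    (·-vanishes _ (⊛-vanishes (degenerateExp ƛ (r × 1#))
      (^-vanishes _ (base-vanishes ƛ) k)))

{-# OPTIONS --safe #-}

-- The generating functions satisfy
--   (1/m!) E Dᵐ · (1/k!) Dᵏ = C(m+k, m) · (1/(m+k)!) E Dᵐ⁺ᵏ,
-- where E = (1+ƛt)^(r/ƛ) and D = (1+ƛt)^(1/ƛ) − 1.  Compare n! times the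
-- coefficients of tⁿ: as Dᵐ and Dᵏ have no terms below degree m and k, the
-- Cauchy product is supported on m ≤ l ≤ n − k.

module Submission where

open import Defs
open import Data.Nat.Base as ℕ using (ℕ; _≥_; _∸_)
open import Data.Nat.Combinatorics using (_C_)

import Algebra.Properties.CommutativeSemigroup as CommutativeSemigroupProperties
import Algebra.Properties.Semiring.Mult as SemiringMult
import Algebra.Properties.Semiring.Sum as SemiringSum
open import Data.Empty using (⊥-elim)
open import Data.Fin.Base using (toℕ)
open import Data.Fin.Properties using (toℕ<n)
open import Data.Nat.Base
  using (zero; suc; _≤_; _<_; _!; z≤n; s≤s; s≤s⁻¹)
open import Data.Nat.Combinatorics using (nCk≡n!/k![n-k]!; k![n∸k]!∣n!)
open import Data.Nat.DivMod using (m/n*n≡m)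
import Data.Nat.Properties as ℕ
open import Function.Base using (_∘_)
open import Relation.Binary.PropositionalEquality as ≡ using (_≡_)
open import Relation.Nullary using (yes; no)

-- The quotient of factorials behind `n C k` is exact because `k ! ℕ.* (n ∸ k) !` divides `n !`. The
-- multiplied-out form can act through `_×_` without any division.
nCk*[k!*[n∸k]!]≡n! : ∀ {n k} → k ≤ n → (n C k) ℕ.* (k ! ℕ.* (n ∸ k) !) ≡ n !
nCk*[k!*[n∸k]!]≡n! {n} {k} k≤n = ≡.trans
  (≡.cong (ℕ._* (k ! ℕ.* (n ∸ k) !)) (nCk≡n!/k![n-k]! k≤n))
  (m/n*n≡m (k![n∸k]!∣n! k≤n))
  where instance _ = k ℕ.!* (n ∸ k) !≢0

module _ {c ℓ} (A : ℚ-Algebra c ℓ) where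

  open ℚ-Algebra A
  open DegenerateStirling A
  open SemiringSum semiring
    using (sum; sum-cong-≋; sum-replicate-zero; ∑-distrib-+; *-distribˡ-sum)
  open SemiringMult semiring
    using (×-congʳ; ×-congˡ; ×-assocˡ; ×-comm-*; ×-assoc-*)
  open CommutativeSemigroupProperties *-commutativeSemigroup using (interchange)
  open import Relation.Binary.Reasoning.Setoid setoid

  -- Lets laws of `_*_`, such as distributivity over sums, apply to natural multiples, and produces
  -- the shape in which `recip-inverse` is stated.
  ×-as-* : ∀ n x → n × x ≈ (n × 1#) * x
  ×-as-* n x = sym (trans (×-assoc-* n 1# x) (×-congʳ n (*-identityˡ x)))

  ×-*-× : ∀ m n x y → (m × x) * (n × y) ≈ (m ℕ.* n) × (x * y)
  ×-*-× m n x y = begin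
    (m × x) * (n × y)      ≈⟨ ×-assoc-* m x (n × y) ⟩
    m × (x * (n × y))      ≈⟨ ×-congʳ m (×-comm-* n x y) ⟩
    m × (n × (x * y))      ≈⟨ ×-assocˡ (x * y) m n ⟩
    (m ℕ.* n) × (x * y)    ∎

  ×-comm : ∀ m n x → m × (n × x) ≈ n × (m × x)
  ×-comm m n x = begin
    m × (n × x)      ≈⟨ ×-assocˡ x m n ⟩
    (m ℕ.* n) × x    ≈⟨ ×-congˡ (ℕ.*-comm m n) ⟩
    (n ℕ.* m) × x    ≈⟨ ×-assocˡ x n m ⟨
    n × (m × x)      ∎

  ×-distrib-sum : ∀ n {N} f → n × sum {N} f ≈ sum {N} (λ i → n × f i)
  ×-distrib-sum n {N} f = begin
    n × sum f                        ≈⟨ ×-as-* n (sum f) ⟩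
    (n × 1#) * sum f                 ≈⟨ *-distribˡ-sum (n × 1#) f ⟩
    sum {N} (λ i → (n × 1#) * f i)   ≈⟨ sum-cong-≋ (λ i → ×-as-* n (f i)) ⟨
    sum {N} (λ i → n × f i)          ∎

  sum-zero : ∀ {N} f → (∀ i → f i ≈ 0#) → sum {N} f ≈ 0#
  sum-zero {N} f f≈0 = trans (sum-cong-≋ f≈0) (sum-replicate-zero N)

  sum-take : ∀ {b N} h → b ≤ N → (∀ l → b ≤ l → l < N → h l ≈ 0#) →
             sum {N} (h ∘ toℕ) ≈ sum {b} (h ∘ toℕ)
  sum-take h z≤n       h≈0 = sum-zero _ (λ i → h≈0 (toℕ i) z≤n (toℕ<n i))
  sum-take h (s≤s b≤N) h≈0 = +-congˡ
    (sum-take (h ∘ suc) b≤N (λ l b≤l l<N → h≈0 (suc l) (s≤s b≤l) (s≤s l<N)))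

  -- Each step removes a vanishing head and shifts `h`. If the sum runs out first, the truncated
  -- `N ∸ a` is zero and both sides are empty.
  sum-drop : ∀ a {N} h → (∀ l → l < a → h l ≈ 0#) →
             sum {N} (h ∘ toℕ) ≈ sum {N ∸ a} (λ i → h (a ℕ.+ toℕ i))
  sum-drop zero            h h≈0 = refl
  sum-drop (suc a) {zero}  h h≈0 = refl
  sum-drop (suc a) {suc N} h h≈0 = begin
    h 0 + sum {N} (h ∘ suc ∘ toℕ)             ≈⟨ +-congʳ (h≈0 0 (s≤s z≤n)) ⟩
    0# + sum {N} (h ∘ suc ∘ toℕ)              ≈⟨ +-identityˡ _ ⟩
    sum {N} (h ∘ suc ∘ toℕ)                   ≈⟨ sum-drop a (h ∘ suc) (λ l l<a → h≈0 (suc l) (s≤s l<a)) ⟩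
    sum {N ∸ a} (λ i → h (suc a ℕ.+ toℕ i))   ∎

  -- Cutting above first leaves `suc b` terms; dropping `a` of them then gives length `suc b ∸ a`,
  -- exactly as in the definition of `sumFromTo a b`.
  sumFromTo-trim : ∀ {a b n} h → b ≤ n →
                   (∀ l → l < a → h l ≈ 0#) →
                   (∀ l → b < l → l ≤ n → h l ≈ 0#) →
                   sumFromTo 0 n h ≈ sumFromTo a b h
  sumFromTo-trim {a} h b≤n low high = trans
    (sum-take h (s≤s b≤n) (λ l b<l l<1+n → high l b<l (s≤s⁻¹ l<1+n)))
    (sum-drop a h low)

  -- The bound on `l` is kept because rewriting `n !` through `n C l` requires `l ≤ n`. It holds
  -- since `suc b ≤ a + i` would force `suc b ∸ a ≤ i`, against the range of `i`.
  sumFromTo-cong : ∀ {a b f g} → (∀ l → l ≤ b → f l ≈ g l) →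
                   sumFromTo a b f ≈ sumFromTo a b g
  sumFromTo-cong {a} {b} f≈g = sum-cong-≋ λ i → f≈g _ (s≤s⁻¹ (ℕ.≰⇒> λ 1+b≤a+i →
    ℕ.<⇒≱ (toℕ<n i) (ℕ.m≤n+o⇒m∸n≤o (suc b) a 1+b≤a+i)))

  ⊛-cong : ∀ {f f′ g g′} → f ≋ f′ → g ≋ g′ → f ⊛ g ≋ f′ ⊛ g′
  ⊛-cong f≋f′ g≋g′ n = sum-cong-≋ {suc n} (λ i → *-cong (f≋f′ (toℕ i)) (g≋g′ (n ∸ toℕ i)))

  ⊛-identityˡ : ∀ g → 𝟙 ⊛ g ≋ g
  ⊛-identityˡ g zero    = trans (+-identityʳ _) (*-identityˡ _)
  ⊛-identityˡ g (suc n) = trans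
    (+-cong (*-identityˡ _) (sum-zero {suc n} (λ i → 0# * g (n ∸ toℕ i)) (λ i → zeroˡ _)))
    (+-identityʳ _)

  ·-⊛-· : ∀ x f y g → (x · f) ⊛ (y · g) ≋ (x * y) · (f ⊛ g)
  ·-⊛-· x f y g n = trans
    (sum-cong-≋ {suc n} (λ i → interchange x (f (toℕ i)) y (g (n ∸ toℕ i))))
    (sym (*-distribˡ-sum {suc n} (x * y) (λ i → f (toℕ i) * g (n ∸ toℕ i))))

  -- Shaped for associativity: with `x` the constant term of a series, `x * f i + g i` is the form
  -- taken by the shifted coefficients of a Cauchy product.
  ⊛-linearˡ : ∀ x f g h n →
              ((λ i → x * f i + g i) ⊛ h) n ≈ x * (f ⊛ h) n + (g ⊛ h) n
  ⊛-linearˡ x f g h n = begin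
    sum {suc n} (λ i → (x * f (toℕ i) + g (toℕ i)) * h (n ∸ toℕ i))
      ≈⟨ sum-cong-≋ {suc n} (λ i → trans
           (distribʳ (h (n ∸ toℕ i)) (x * f (toℕ i)) (g (toℕ i)))
           (+-congʳ (*-assoc x (f (toℕ i)) (h (n ∸ toℕ i))))) ⟩
    sum {suc n} (λ i → x * (f (toℕ i) * h (n ∸ toℕ i)) + g (toℕ i) * h (n ∸ toℕ i))
      ≈⟨ ∑-distrib-+ {suc n} (λ i → x * (f (toℕ i) * h (n ∸ toℕ i))) (λ i → g (toℕ i) * h (n ∸ toℕ i)) ⟩
    sum {suc n} (λ i → x * (f (toℕ i) * h (n ∸ toℕ i))) + (g ⊛ h) n
      ≈⟨ +-congʳ (*-distribˡ-sum {suc n} x (λ i → f (toℕ i) * h (n ∸ toℕ i))) ⟨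
    x * (f ⊛ h) n + (g ⊛ h) n ∎

  -- Induction on the coefficient, via the definitional recursion
  -- (f ⊛ g) (1 + n) = f 0 * g (1 + n) + ((f ∘ suc) ⊛ g) n.
  ⊛-assoc : ∀ f g h → (f ⊛ g) ⊛ h ≋ f ⊛ (g ⊛ h)
  ⊛-assoc f g h zero = +-congʳ (begin
    (f 0 * g 0 + 0#) * h 0   ≈⟨ *-congʳ (+-identityʳ _) ⟩
    (f 0 * g 0) * h 0        ≈⟨ *-assoc _ _ _ ⟩
    f 0 * (g 0 * h 0)        ≈⟨ *-congˡ (+-identityʳ _) ⟨
    f 0 * (g 0 * h 0 + 0#)   ∎)
  ⊛-assoc f g h (suc n) = begin
    (f 0 * g 0 + 0#) * h (suc n) + ((λ i → f 0 * g (suc i) + ((f ∘ suc) ⊛ g) i) ⊛ h) n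
      ≈⟨ +-cong (trans (*-congʳ (+-identityʳ _)) (*-assoc _ _ _))
                (⊛-linearˡ (f 0) (g ∘ suc) ((f ∘ suc) ⊛ g) h n) ⟩
    f 0 * (g 0 * h (suc n)) + (f 0 * ((g ∘ suc) ⊛ h) n + (((f ∘ suc) ⊛ g) ⊛ h) n)
      ≈⟨ +-assoc _ _ _ ⟨
    (f 0 * (g 0 * h (suc n)) + f 0 * ((g ∘ suc) ⊛ h) n) + (((f ∘ suc) ⊛ g) ⊛ h) n
      ≈⟨ +-cong (sym (distribˡ _ _ _)) (⊛-assoc (f ∘ suc) g h n) ⟩
    f 0 * (g ⊛ h) (suc n) + ((f ∘ suc) ⊛ (g ⊛ h)) n ∎

  ^-homo-⊛ : ∀ f m k → f ^ m ⊛ f ^ k ≋ f ^ (m ℕ.+ k)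
  ^-homo-⊛ f zero    k   = ⊛-identityˡ (f ^ k)
  ^-homo-⊛ f (suc m) k n = trans
    (⊛-assoc f (f ^ m) (f ^ k) n)
    (⊛-cong {f} (λ _ → refl) (^-homo-⊛ f m k) n)

  !-inverseˡ : ∀ n → ((n !) × 1#) * 1/ n ! ≈ 1#
  !-inverseˡ n = recip-inverse (n !) {{n ℕ.!≢0}}

  -- Multiply by `(m + k)!` times its reciprocal, split that factorial as the binomial coefficient
  -- times `m !` and `k !`, and cancel these two against their own reciprocals.
  1/!-*-1/! : ∀ m k → 1/ m ! * 1/ k ! ≈ ((m ℕ.+ k) C m) × 1/ (m ℕ.+ k) !
  1/!-*-1/! m k = begin
    1/ m ! * 1/ k !                                       ≈⟨ *-identityʳ _ ⟨
    (1/ m ! * 1/ k !) * 1#                                ≈⟨ *-congˡ (!-inverseˡ (m ℕ.+ k)) ⟨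
    (1/ m ! * 1/ k !) * ((((m ℕ.+ k) !) × 1#) * w)        ≈⟨ *-congˡ (×-as-* ((m ℕ.+ k) !) w) ⟨
    (1/ m ! * 1/ k !) * (((m ℕ.+ k) !) × w)               ≈⟨ *-congˡ (×-congˡ factorials) ⟨
    (1/ m ! * 1/ k !) * ((b ℕ.* (m ! ℕ.* k !)) × w)       ≈⟨ *-congˡ (×-congˡ (ℕ.*-comm b (m ! ℕ.* k !))) ⟩
    (1/ m ! * 1/ k !) * (((m ! ℕ.* k !) ℕ.* b) × w)       ≈⟨ *-congˡ (×-assocˡ w (m ! ℕ.* k !) b) ⟨
    (1/ m ! * 1/ k !) * ((m ! ℕ.* k !) × (b × w))         ≈⟨ ×-comm-* (m ! ℕ.* k !) _ _ ⟩
    (m ! ℕ.* k !) × ((1/ m ! * 1/ k !) * (b × w))         ≈⟨ ×-assoc-* (m ! ℕ.* k !) _ _ ⟨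
    ((m ! ℕ.* k !) × (1/ m ! * 1/ k !)) * (b × w)         ≈⟨ *-congʳ (×-*-× (m !) (k !) _ _) ⟨
    (((m !) × 1/ m !) * ((k !) × 1/ k !)) * (b × w)       ≈⟨ *-congʳ (*-cong (cancel m) (cancel k)) ⟩
    (1# * 1#) * (b × w)                                   ≈⟨ *-congʳ (*-identityˡ 1#) ⟩
    1# * (b × w)                                          ≈⟨ *-identityˡ _ ⟩
    b × w                                                 ∎
    where
    b = (m ℕ.+ k) C m
    w = 1/ (m ℕ.+ k) !

    cancel : ∀ n → (n !) × 1/ n ! ≈ 1#
    cancel n = trans (×-as-* (n !) _) (!-inverseˡ n)

    factorials : b ℕ.* (m ! ℕ.* k !) ≡ (m ℕ.+ k) !
    factorials = ≡.trans
      (≡.cong (λ j → b ℕ.* (m ! ℕ.* j !)) (≡.sym (ℕ.m+n∸m≡n m k)))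
      (nCk*[k!*[n∸k]!]≡n! (ℕ.m≤m+n m k))

  egfFrom-vanishes : ∀ {k n} a → n < k → egfFrom k a n ≈ 0#
  egfFrom-vanishes {k} {n} a n<k with k ℕ.≤? n
  ... | yes k≤n = ⊥-elim (ℕ.<⇒≱ n<k k≤n)
  ... | no  _   = refl

  -- Read off from the defining expansion, whose right-hand side `egfFrom k` is `0#` below degree
  -- `k` by construction.
  stirling₂-vanishes : ∀ ƛ {k n} → n < k → stirling₂Series ƛ k n ≈ 0#
  stirling₂-vanishes ƛ {k} {n} n<k =
    trans (stirling₂-egf ƛ k n) (egfFrom-vanishes _ n<k)

  extendedStirling₂-vanishes : ∀ r ƛ {k n} → n < k →
                               extendedStirling₂Series r ƛ k n ≈ 0#
  extendedStirling₂-vanishes r ƛ {k} {n} n<k =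
    trans (extendedStirling₂-egf r ƛ k n) (egfFrom-vanishes _ n<k)

  -- Only the left factor carries `E`, so reassociating brings the two powers of `D` together. The
  -- binomial coefficient comes solely from the scalars.
  extendedStirling₂-⊛-stirling₂ : ∀ r ƛ m k n →
    (extendedStirling₂Series r ƛ m ⊛ stirling₂Series ƛ k) n
      ≈ ((m ℕ.+ k) C m) × extendedStirling₂Series r ƛ (m ℕ.+ k) n
  extendedStirling₂-⊛-stirling₂ r ƛ m k n = begin
    ((1/ m ! · (E ⊛ D ^ m)) ⊛ (1/ k ! · D ^ k)) n
      ≈⟨ ·-⊛-· (1/ m !) (E ⊛ D ^ m) (1/ k !) (D ^ k) n ⟩
    (1/ m ! * 1/ k !) * ((E ⊛ D ^ m) ⊛ D ^ k) n
      ≈⟨ *-congˡ (⊛-assoc E (D ^ m) (D ^ k) n) ⟩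
    (1/ m ! * 1/ k !) * (E ⊛ (D ^ m ⊛ D ^ k)) n
      ≈⟨ *-cong (1/!-*-1/! m k) (⊛-cong {E} (λ _ → refl) (^-homo-⊛ D m k) n) ⟩
    (((m ℕ.+ k) C m) × 1/ (m ℕ.+ k) !) * (E ⊛ D ^ (m ℕ.+ k)) n
      ≈⟨ ×-assoc-* ((m ℕ.+ k) C m) _ _ ⟩
    ((m ℕ.+ k) C m) × (1/ (m ℕ.+ k) ! * (E ⊛ D ^ (m ℕ.+ k)) n) ∎
    where
    E = degenerateExp ƛ (r × 1#)
    D = degenerateExp ƛ 1# ⊖ 𝟙

  -- Distributes `n !` over a term of the Cauchy product, so that each coefficient receives the
  -- factorial that turns it into a Stirling number.
  !-×-* : ∀ {n l} → l ≤ n → ∀ x y →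
          (n !) × (x * y) ≈ (n C l) × (((l !) × x) * (((n ∸ l) !) × y))
  !-×-* {n} {l} l≤n x y = begin
    (n !) × (x * y)                                   ≈⟨ ×-congˡ (nCk*[k!*[n∸k]!]≡n! l≤n) ⟨
    ((n C l) ℕ.* (l ! ℕ.* (n ∸ l) !)) × (x * y)       ≈⟨ ×-assocˡ _ (n C l) _ ⟨
    (n C l) × ((l ! ℕ.* (n ∸ l) !) × (x * y))         ≈⟨ ×-congʳ (n C l) (×-*-× (l !) ((n ∸ l) !) x y) ⟨
    (n C l) × (((l !) × x) * (((n ∸ l) !) × y))       ∎

-- By contraposition: `k ≤ n ∸ l` gives `n ∸ (n ∸ l) ≤ n ∸ k`, and the left side is `l` because
-- `l ≤ n`.
n∸k<l≤n⇒n∸l<k : ∀ {n k l} → n ∸ k < l → l ≤ n → n ∸ l < k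
n∸k<l≤n⇒n∸l<k {n} {k} {l} n∸k<l l≤n = ℕ.≰⇒> λ k≤n∸l →
  ℕ.<⇒≱ n∸k<l (≡.subst (_≤ n ∸ k) (ℕ.m∸[m∸n]≡n l≤n) (ℕ.∸-monoʳ-≤ n k≤n∸l))

theorem2p6 : ∀ {c ℓ} (A : ℚ-Algebra c ℓ) →
  let open ℚ-Algebra A
      open DegenerateStirling A
  in (ƛ : Carrier) (r n m k : ℕ) → n ≥ m ℕ.+ k →
     ((m ℕ.+ k) C m) × S₂⟨ r ⟩[ n +r, m ℕ.+ k +r∣ ƛ ]
       ≈ ∑[ l from m to n ∸ k ]
           ((n C l) × (S₂⟨ r ⟩[ l +r, m +r∣ ƛ ] * S₂[ n ∸ l , k ∣ ƛ ]))
theorem2p6 A ƛ r n m k n≥m+k = begin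
  b × ((n !) × F (m ℕ.+ k) n)
    ≈⟨ ×-comm A b (n !) _ ⟩
  (n !) × (b × F (m ℕ.+ k) n)
    ≈⟨ ×-congʳ (n !) (extendedStirling₂-⊛-stirling₂ A r ƛ m k n) ⟨
  -- The Cauchy product is this sum by computation: `suc n ∸ 0` and `0 + toℕ i` both reduce.
  (n !) × sumFromTo 0 n (λ l → F m l * G k (n ∸ l))
    ≈⟨ ×-congʳ (n !) (sumFromTo-trim A {m} (λ l → F m l * G k (n ∸ l)) (ℕ.m∸n≤m n k)
         -- For `l < m` the factor `F m l` is zero; for `l > n ∸ k` the index `n ∸ l` falls below
         -- `k`, so the other factor is.
         (λ l l<m → trans (*-congʳ (extendedStirling₂-vanishes A r ƛ l<m)) (zeroˡ _))
         (λ l n∸k<l l≤n → trans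
           (*-congˡ (stirling₂-vanishes A ƛ {k} (n∸k<l≤n⇒n∸l<k n∸k<l l≤n))) (zeroʳ _))) ⟩
  (n !) × sumFromTo m (n ∸ k) (λ l → F m l * G k (n ∸ l))
    ≈⟨ ×-distrib-sum A (n !) {suc (n ∸ k) ∸ m} _ ⟩
  sumFromTo m (n ∸ k) (λ l → (n !) × (F m l * G k (n ∸ l)))
    ≈⟨ sumFromTo-cong A {m} (λ l l≤n∸k →
         !-×-* A (ℕ.≤-trans l≤n∸k (ℕ.m∸n≤m n k)) (F m l) (G k (n ∸ l))) ⟩
  sumFromTo m (n ∸ k)
    (λ l → (n C l) × (S₂⟨ r ⟩[ l +r, m +r∣ ƛ ] * S₂[ n ∸ l , k ∣ ƛ ])) ∎
  where
  open ℚ-Algebra A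
  open DegenerateStirling A
  open SemiringMult semiring using (×-congʳ)
  open import Relation.Binary.Reasoning.Setoid setoid

  b = (m ℕ.+ k) C m
  F = extendedStirling₂Series r ƛ
  G = stirling₂Series ƛ
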